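{- The competitive ratio of any deterministic algorithm for $(1+\varepsilon)$-overprovisioned $\Delta$-recoloring is $\Omega(\Delta)$. That is, for every constant $\varepsilon\in(0,1)$ there are constants $\kappa>0$ and $\Delta_0$ (depending only on $\varepsilon$) such that for every integer $\Delta\ge\Delta_0$, every sufficiently large $n$ (depending on $\varepsilon$ and $\Delta$) divisible by $\Delta$, and every deterministic online algorithm $\mathcal A$ for $(1+\varepsilon)$-overprovisioned $\Delta$-recoloring on $n$ vertices: if $\mathcal A_\sigma\le\alpha\,OPT_\sigma$ for every admissible request sequence $\sigma$, then $\alpha\ge\kappa\Delta$.
   Context: $(1+\varepsilon)$-overprovisioned $\Delta$-recoloring. There is a fixed set $V$ of $n$ vertices (with $n$ divisible by $\Delta$), each of weight $1$, and an initial coloring $c_0:V\to[\Delta]=\{1,\dots,\Delta\}$ in which each color is used by exactly $n/\Delta$ vertices. A finite sequence $\sigma=(\sigma_1,\dots,\sigma_T)$ of edges $\sigma_t=(u_t,v_t)$ between distinct vertices of $V$ is revealed one at a time. Let $G_t$ be the graph on $V$ with edges $\sigma_1,\dots,\sigma_t$. The sequence is admissible if the maximum degree of $G_T$ is at most $(1-\varepsilon)\Delta$. After each request $\sigma_t$ the online algorithm must output a proper coloring $c_t:V\to[\Delta]$ of $G_t$ in which each color is used by at most $(1+\varepsilon)\frac n\Delta$ vertices. Recoloring one vertex costs $1$, so the total cost is $\sum_{t=1}^T|\{v:c_t(v)\ne c_{t-1}(v)\}|$. A deterministic online algorithm determines $c_t$ from $c_0$ and $\sigma_1,\dots,\sigma_t$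 only. $\mathcal A_\sigma$ denotes the total cost of $\mathcal A$ on $\sigma$. $OPT_\sigma$ denotes the minimum total cost of an offline algorithm (which knows all of $\sigma$ in advance) that uses the same $\Delta$ colors and maintains proper colorings of the $G_t$, but with no capacity restriction on the colors. -}

module Defs where

import Algebra.Properties.CommutativeMonoid.Sum
open import Data.Fin.Base using (Fin; toℕ; inject₁)
import Data.Fin.Properties as Fin
open import Data.Integer.Base using (+_)
open import Data.List.Base using (List; length; filter; allFin; map; take)
open import Data.List.Extrema.Nat using (max)
open import Data.List.Relation.Unary.Any using (Any; any?)
open import Data.Nat.Base as ℕ using (ℕ; zero; suc; NonZero)
import Data.Nat.Properties as ℕ
open import Data.Product.Base using (_×_; _,_; ∃; ∃-syntax)
open import Data.Rational.Base as ℚ using (ℚ; 0ℚ; 1ℚ; ½; ∣_∣)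
import Data.Rational.Properties as ℚ
open import Data.Rational.Solver using (module +-*-Solver)
open import Data.Sum.Base using (_⊎_)
open import Data.Vec.Functional using (Vector; _∷_)
open import Relation.Binary.PropositionalEquality using (_≡_; _≢_; refl; sym; cong; subst)
open import Relation.Nullary using (¬_; ¬?; Dec; _×-dec_; _⊎-dec_)
open import Relation.Unary using (Decidable)

open Algebra.Properties.CommutativeMonoid.Sum ℕ.+-0-commutativeMonoid using (sum)

record ℝ : Set where
  field
    approx : ℕ → ℚ
    cauchy : ∀ δ → 0ℚ ℚ.< δ →
             ∃[ N ] ∀ i j → N ℕ.≤ i → N ℕ.≤ j → ∣ approx i ℚ.- approx j ∣ ℚ.< δ

open ℝ public

infix 4 _<ℝ_ _≤ℝ_
infixl 6 _+ℝ_ _-ℝ_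
infixr 8 _·_

_<ℝ_ : ℝ → ℝ → Set
x <ℝ y = ∃[ δ ] 0ℚ ℚ.< δ × ∃[ N ] ∀ i → N ℕ.≤ i → approx x i ℚ.+ δ ℚ.≤ approx y i

-- For Cauchy sequences with a modulus this is equivalent to: for every δ > 0,
-- approx x i ≤ approx y i + δ for all sufficiently large i.
_≤ℝ_ : ℝ → ℝ → Set
x ≤ℝ y = ¬ (y <ℝ x)

fromℚ : ℚ → ℝ
fromℚ q = record
  { approx = λ _ → q
  ; cauchy = λ δ δ>0 → 0 , λ _ _ _ _ →
      subst (λ r → ∣ r ∣ ℚ.< δ) (sym (ℚ.+-inverseʳ q)) δ>0
  }

fromℕ : ℕ → ℝ
fromℕ m = fromℚ (+ m ℚ./ 1)

0ℝ 1ℝ : ℝ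
0ℝ = fromℚ 0ℚ
1ℝ = fromℚ 1ℚ

private
  half-pos : ∀ {δ} → 0ℚ ℚ.< δ → 0ℚ ℚ.< ½ ℚ.* δ
  half-pos {δ} δ>0 = ℚ.positive⁻¹ (½ ℚ.* δ) {{ℚ.pos*pos⇒pos ½ δ {{ℚ.positive δ>0}}}}

  half+half : ∀ δ → ½ ℚ.* δ ℚ.+ ½ ℚ.* δ ≡ δ
  half+half δ = begin
    ½ ℚ.* δ ℚ.+ ½ ℚ.* δ  ≡⟨ ℚ.*-distribʳ-+ δ ½ ½ ⟨
    1ℚ ℚ.* δ             ≡⟨ ℚ.*-identityˡ δ ⟩
    δ                    ∎
    where open Relation.Binary.PropositionalEquality.≡-Reasoning

  +-dist : ∀ a b c d → (a ℚ.+ b) ℚ.- (c ℚ.+ d) ≡ (a ℚ.- c) ℚ.+ (b ℚ.- d)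
  +-dist = solve 4 (λ a b c d → (a :+ b) :- (c :+ d) := (a :- c) :+ (b :- d)) refl
    where open +-*-Solver

  neg-dist : ∀ a b → (ℚ.- a) ℚ.- (ℚ.- b) ≡ ℚ.- (a ℚ.- b)
  neg-dist = solve 2 (λ a b → (:- a) :- (:- b) := :- (a :- b)) refl
    where open +-*-Solver

_+ℝ_ : ℝ → ℝ → ℝ
approx (x +ℝ y) i = approx x i ℚ.+ approx y i
cauchy (x +ℝ y) δ δ>0
  with Nx , hx ← cauchy x (½ ℚ.* δ) (half-pos δ>0)
  with Ny , hy ← cauchy y (½ ℚ.* δ) (half-pos δ>0)
  = Nx ℕ.⊔ Ny , λ i j N≤i N≤j →
    let open ℚ.≤-Reasoning
        a = approx x i ; b = approx y i ; c = approx x j ; d = approx y j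
    in begin-strict
      ∣ (a ℚ.+ b) ℚ.- (c ℚ.+ d) ∣        ≡⟨ cong ∣_∣ (+-dist a b c d) ⟩
      ∣ (a ℚ.- c) ℚ.+ (b ℚ.- d) ∣        ≤⟨ ℚ.∣p+q∣≤∣p∣+∣q∣ (a ℚ.- c) (b ℚ.- d) ⟩
      ∣ a ℚ.- c ∣ ℚ.+ ∣ b ℚ.- d ∣        <⟨ ℚ.+-mono-<
        (hx i j (ℕ.m⊔n≤o⇒m≤o Nx Ny N≤i) (ℕ.m⊔n≤o⇒m≤o Nx Ny N≤j))
        (hy i j (ℕ.m⊔n≤o⇒n≤o Nx Ny N≤i) (ℕ.m⊔n≤o⇒n≤o Nx Ny N≤j)) ⟩
      ½ ℚ.* δ ℚ.+ ½ ℚ.* δ                ≡⟨ half+half δ ⟩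
      δ                                  ∎

-ℝ_ : ℝ → ℝ
approx (-ℝ x) i = ℚ.- approx x i
cauchy (-ℝ x) δ δ>0 with N , h ← cauchy x δ δ>0 = N , λ i j N≤i N≤j →
  let open ℚ.≤-Reasoning
      a = approx x i ; b = approx x j
  in begin-strict
    ∣ (ℚ.- a) ℚ.- (ℚ.- b) ∣  ≡⟨ cong ∣_∣ (neg-dist a b) ⟩
    ∣ ℚ.- (a ℚ.- b) ∣        ≡⟨ ℚ.∣-p∣≡∣p∣ (a ℚ.- b) ⟩
    ∣ a ℚ.- b ∣              <⟨ h i j N≤i N≤j ⟩
    δ                        ∎

_-ℝ_ : ℝ → ℝ → ℝ
x -ℝ y = x +ℝ (-ℝ y)

-- The product of a natural number and a real; every product of reals that
-- occurs below has a natural-number factor.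
_·_ : ℕ → ℝ → ℝ
zero  · x = 0ℝ
suc m · x = x +ℝ m · x

#[_] : ∀ {n} {P : Fin n → Set} → Decidable P → ℕ
#[_] {n} P? = length (filter P? (allFin n))

record Edge (n : ℕ) : Set where
  constructor edge
  field
    src dst   : Fin n
    .distinct : src ≢ dst

open Edge public

-- The graph G_t is represented by the list of requests σ_1, …, σ_t; repeated
-- requests of the same edge do not increase degrees.

Joins : ∀ {n} → Fin n → Fin n → Edge n → Set
Joins u v e = (src e ≡ u × dst e ≡ v) ⊎ (src e ≡ v × dst e ≡ u)

Adjacent : ∀ {n} → List (Edge n) → Fin n → Fin n → Set
Adjacent σ u v = Any (Joins u v) σ

adjacent? : ∀ {n} (σ : List (Edge n)) (u v : Fin n) → Dec (Adjacent σ u v)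
adjacent? σ u v = any?
  (λ e → (src e Fin.≟ u ×-dec dst e Fin.≟ v) ⊎-dec (src e Fin.≟ v ×-dec dst e Fin.≟ u)) σ

degree : ∀ {n} → List (Edge n) → Fin n → ℕ
degree σ v = #[ adjacent? σ v ]

maxDegree : ∀ {n} → List (Edge n) → ℕ
maxDegree {n} σ = max 0 (map (degree σ) (allFin n))

Admissible : ∀ {n} → ℝ → ℕ → List (Edge n) → Set
Admissible ε Δ σ = fromℕ (maxDegree σ) ≤ℝ Δ · (1ℝ -ℝ ε)

-- prefix σ t consists of the first toℕ t + 1 requests.
prefix : ∀ {n} (σ : List (Edge n)) → Fin (length σ) → List (Edge n)
prefix σ t = take (suc (toℕ t)) σ

Coloring : ℕ → ℕ → Set
Coloring n Δ = Fin n → Fin Δ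

module _ {n Δ : ℕ} where

  classSize : Coloring n Δ → Fin Δ → ℕ
  classSize c k = #[ (λ v → c v Fin.≟ k) ]

  Proper : List (Edge n) → Coloring n Δ → Set
  Proper σ c = ∀ u v → Adjacent σ u v → c u ≢ c v

  recolorings : Coloring n Δ → Coloring n Δ → ℕ
  recolorings c c′ = #[ (λ v → ¬? (c′ v Fin.≟ c v)) ]

  -- A vector cs : Vector (Coloring n Δ) T lists c_1, …, c_T: the entry at
  -- t : Fin T is the coloring output after request number toℕ t + 1.
  totalCost : Coloring n Δ → ∀ {T} → Vector (Coloring n Δ) T → ℕ
  totalCost c₀ cs = sum (λ t → recolorings ((c₀ ∷ cs) (inject₁ t)) (cs t))

  MaintainsProper : (σ : List (Edge n)) → Vector (Coloring n Δ) (length σ) → Set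
  MaintainsProper σ cs = ∀ t → Proper (prefix σ t) (cs t)

  IsOPT : Coloring n Δ → List (Edge n) → ℕ → Set
  IsOPT c₀ σ m =
    (∃[ cs ] MaintainsProper σ cs × totalCost c₀ cs ≡ m) ×
    (∀ cs → MaintainsProper σ cs → m ℕ.≤ totalCost c₀ cs)

  module _ .{{_ : NonZero Δ}} where

    Balanced : Coloring n Δ → Set
    Balanced c = ∀ k → classSize c k ≡ n ℕ./ Δ

    -- Only used when Δ divides n, so that n ℕ./ Δ is exact.
    WithinCapacity : ℝ → Coloring n Δ → Set
    WithinCapacity ε c = ∀ k → fromℕ (classSize c k) ≤ℝ (n ℕ./ Δ) · (1ℝ +ℝ ε)

    -- The value of respond at the empty list is never used: before the first
    -- request the coloring is c₀.
    record OnlineAlgorithm (ε : ℝ) (c₀ : Coloring n Δ) : Set where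
      field
        respond : List (Edge n) → Coloring n Δ

      run : (σ : List (Edge n)) → Vector (Coloring n Δ) (length σ)
      run σ t = respond (prefix σ t)

      field
        proper   : ∀ σ → Admissible ε Δ σ → MaintainsProper σ (run σ)
        capacity : ∀ σ → Admissible ε Δ σ → ∀ t → WithinCapacity ε (run σ t)

      cost : List (Edge n) → ℕ
      cost σ = totalCost c₀ (run σ)

    Competitive : ∀ {ε c₀} → OnlineAlgorithm ε c₀ → ℝ → Set
    Competitive {ε} {c₀} A α = ∀ σ → Admissible ε Δ σ → ∀ opt → IsOPT c₀ σ opt →
      fromℕ (OnlineAlgorithm.cost A σ) ≤ℝ opt · α

{-# OPTIONS --safe #-}

-- Let d = ⌊Δ/Q⌋, where Q ≥ 2 and 1/Q is at most a rational δ > 0 with δ ≤ 1 − ε.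
-- The adversary fixes a vertex v and repeatedly joins it to a vertex u that still
-- has its initial color and currently shares the color of v, so that every request
-- forces a recoloring.  As long as fewer than d recolorings have happened, such a u
-- exists because the initial color classes have more than d vertices.  The requests
-- form a star with at most d < Δ edges, so offline a single recoloring of v
-- suffices, whereas the online algorithm pays d ≥ Δ/(2Q).

module Submission where

open import Defs
open import Data.Nat.Base using (ℕ; NonZero; _≤_)
open import Data.Nat.Divisibility using (_∣_)
open import Data.Product.Base using (_×_; ∃-syntax)

import Algebra.Properties.CommutativeMonoid.Sum
open import Data.Empty using (⊥-elim-irr)
open import Data.Unit.Base using (⊤)
open import Data.Fin.Base using (Fin; zero; suc; toℕ; fromℕ<)
import Data.Fin.Base as Fin
import Data.Fin.Properties as Fin
open import Data.Integer.Base as ℤ using (+_; -[1+_])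
import Data.Integer.Properties as ℤ
open import Data.List.Base using (List; []; _∷_; _∷ʳ_; length; filter; allFin; map; lookup)
open import Data.List.Extrema.Nat using (max≤v⁺)
import Data.List.Membership.DecPropositional as DecMembership
open import Data.List.Membership.Propositional using (_∈_; _∉_; lose)
open import Data.List.Membership.Propositional.Properties using (∈-allFin; ∈-map⁺)
open import Data.List.Properties using (take-all; filter-some; length-map; length-++)
open import Data.List.Relation.Unary.All as All using (All; []; _∷_)
import Data.List.Relation.Unary.All.Properties as All
open import Data.List.Relation.Unary.AllPairs using ([]; _∷_)
open import Data.List.Relation.Unary.Any using (here; there; index)
import Data.List.Relation.Unary.Any.Properties as Any
open import Data.List.Relation.Unary.Unique.Propositional using (Unique)
import Data.List.Relation.Unary.Unique.Propositional.Properties as Unique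
open import Data.Nat.Base as ℕ using (zero; suc; _+_; _*_; _/_; _<_; z≤n; s≤s)
import Data.Nat.DivMod as ℕ
import Data.Nat.Properties as ℕ
open import Data.Product.Base using (_,_; proj₁; proj₂; ∃)
open import Data.Rational.Base as ℚ using (ℚ; mkℚ; 0ℚ; 1ℚ; toℚᵘ)
import Data.Rational.Properties as ℚ
open import Data.Rational.Solver using (module +-*-Solver)
open import Data.Rational.Unnormalised.Base as ℚᵘ using (mkℚᵘ; *≡*)
import Data.Rational.Unnormalised.Properties as ℚᵘ
open import Data.Sum.Base using (_⊎_; inj₁; inj₂)
open import Data.Vec.Functional using (Vector; updateAt)
open import Data.Vec.Functional.Properties using (updateAt-updates; updateAt-minimal)
open import Function.Base using (_∘_; const; id)
open import Relation.Binary.PropositionalEquality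
open import Relation.Nullary using (¬_; ¬?; Dec; yes; no; contradiction; _×-dec_; _⊎-dec_)
open import Relation.Nullary.Decidable using (decidable-stable)
open import Relation.Unary using (Decidable)

open Algebra.Properties.CommutativeMonoid.Sum ℕ.+-0-commutativeMonoid
  using (sum-cong-≗)

-- Counting the elements of decidable subsets of a finite set.

module _ {A : Set} {P Q R : A → Set} (P? : Decidable P) (Q? : Decidable Q) (R? : Decidable R)
         (P⊆Q∪R : ∀ x → P x → Q x ⊎ R x) where

  length-filter-∪ : ∀ xs → length (filter P? xs) ≤ length (filter Q? xs) + length (filter R? xs)
  length-filter-∪ [] = z≤n
  length-filter-∪ (x ∷ xs) with ih ← length-filter-∪ xs | P? x | Q? x | R? x
  ... | no _  | no _  | no _  = ih
  ... | no _  | no _  | yes _ = ℕ.≤-trans ih (ℕ.+-monoʳ-≤ _ (ℕ.n≤1+n _))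
  ... | no _  | yes _ | no _  = ℕ.m≤n⇒m≤1+n ih
  ... | no _  | yes _ | yes _ = ℕ.m≤n⇒m≤1+n (ℕ.≤-trans ih (ℕ.+-monoʳ-≤ _ (ℕ.n≤1+n _)))
  ... | yes _ | yes _ | no _  = s≤s ih
  ... | yes _ | yes _ | yes _ = s≤s (ℕ.≤-trans ih (ℕ.+-monoʳ-≤ _ (ℕ.n≤1+n _)))
  ... | yes _ | no _  | yes _ = ℕ.≤-trans (s≤s ih) (ℕ.≤-reflexive (sym (ℕ.+-suc _ _)))
  ... | yes p | no ¬q | no ¬r with P⊆Q∪R x p
  ...   | inj₁ q = contradiction q ¬q
  ...   | inj₂ r = contradiction r ¬r

Unique∧subsingleton⇒length≤1 : ∀ {A : Set} {P : A → Set} → (∀ {x y} → P x → P y → x ≡ y) →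
                               ∀ {xs} → Unique xs → All P xs → length xs ≤ 1
Unique∧subsingleton⇒length≤1 prop {[]}        _                 _             = z≤n
Unique∧subsingleton⇒length≤1 prop {_ ∷ []}    _                 _             = s≤s z≤n
Unique∧subsingleton⇒length≤1 prop {_ ∷ _ ∷ _} ((x≢y ∷ _) ∷ _) (px ∷ py ∷ _) =
  contradiction (prop px py) x≢y

#-∪ : ∀ {n} {P Q R : Fin n → Set} (P? : Decidable P) (Q? : Decidable Q) (R? : Decidable R) →
      (∀ x → P x → Q x ⊎ R x) → #[ P? ] ≤ #[ Q? ] + #[ R? ]
#-∪ P? Q? R? P⊆Q∪R = length-filter-∪ P? Q? R? P⊆Q∪R (allFin _)

module _ {n : ℕ} {P : Fin n → Set} (P? : Decidable P) where

  #≤1 : (∀ {x y} → P x → P y → x ≡ y) → #[ P? ] ≤ 1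
  #≤1 prop = Unique∧subsingleton⇒length≤1 prop
    (Unique.filter⁺ P? (Unique.allFin⁺ n)) (All.all-filter P? (allFin n))

  #≡0 : (∀ x → ¬ P x) → #[ P? ] ≡ 0
  #≡0 ¬P with filter P? (allFin n) | All.all-filter P? (allFin n)
  ... | []    | _       = refl
  ... | x ∷ _ | px ∷ _ = contradiction px (¬P x)

  #>0 : ∀ {x} → P x → 1 ≤ #[ P? ]
  #>0 {x} px = filter-some P? (lose (∈-allFin x) px)

  #>0⇒∃ : 1 ≤ #[ P? ] → ∃ P
  #>0⇒∃ 1≤# = decidable-stable (Fin.any? P?) λ ¬∃ →
    ℕ.n≮0 (subst (1 ≤_) (#≡0 λ x px → ¬∃ (x , px)) 1≤#)

-- Degrees in a request list, and colors missing from a list.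

module _ {n : ℕ} where

  -- Induction on the requests: one edge determines the other endpoint, so each request gives `w` at
  -- most one new neighbor.
  degree≤length : ∀ (σ : List (Edge n)) w → degree σ w ≤ length σ
  degree≤length [] w = ℕ.≤-reflexive (#≡0 (adjacent? [] w) λ _ ())
  degree≤length (e ∷ σ) w = ℕ.≤-trans
    (#-∪ (adjacent? (e ∷ σ) w) (adjacent? (e ∷ []) w) (adjacent? σ w)
      λ { _ (here j) → inj₁ (here j) ; _ (there a) → inj₂ a })
    (ℕ.+-mono-≤ (#≤1 (adjacent? (e ∷ []) w) unique) (degree≤length σ w))
    where
    unique : ∀ {x y} → Adjacent (e ∷ []) w x → Adjacent (e ∷ []) w y → x ≡ y
    unique (here (inj₁ (_ , p))) (here (inj₁ (_ , q))) = trans (sym p) q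
    unique (here (inj₁ (s , p))) (here (inj₂ (t , q))) = trans (trans (sym p) q) (trans (sym s) t)
    unique (here (inj₂ (s , p))) (here (inj₁ (t , q))) = trans (trans (sym s) t) (trans (sym p) q)
    unique (here (inj₂ (s , _))) (here (inj₂ (t , _))) = trans (sym s) t

  maxDegree≤length : ∀ (σ : List (Edge n)) → maxDegree σ ≤ length σ
  maxDegree≤length σ = max≤v⁺ {xs = map (degree σ) (allFin n)} z≤n
    (All.map⁺ (All.universal (degree≤length σ) (allFin n)))

-- Pigeonhole: if every element occurred in `xs`, sending it to the position of an occurrence would
-- inject `Fin m` into the fewer positions of `xs`.
∃∉ : ∀ {m} (xs : List (Fin m)) → length xs < m → ∃ (_∉ xs)
∃∉ xs |xs|<m = decidable-stable (Fin.any? (λ k → ¬? (k ∈? xs))) λ ¬∃ →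
  let k∈ : ∀ k → k ∈ xs
      k∈ k = decidable-stable (k ∈? xs) λ k∉ → ¬∃ (k , k∉)
  in ℕ.<⇒≱ |xs|<m (Fin.injective⇒≤ {f = index ∘ k∈} λ {i} {j} eq →
       trans (Any.lookup-index (k∈ i)) (trans (cong (lookup xs) eq) (sym (Any.lookup-index (k∈ j)))))
  where open DecMembership Fin._≟_ using (_∈?_)

-- Recoloring costs along a request sequence.

module _ {n Δ : ℕ} where

  recolorings-refl : ∀ (c : Coloring n Δ) → recolorings c c ≡ 0
  recolorings-refl c = #≡0 (λ v → ¬? (c v Fin.≟ c v)) λ v cv≢cv → cv≢cv refl

  recolorings-triangle : ∀ (c c′ c″ : Coloring n Δ) →
                         recolorings c c″ ≤ recolorings c c′ + recolorings c′ c″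
  recolorings-triangle c c′ c″ = #-∪ _ (λ v → ¬? (c′ v Fin.≟ c v)) (λ v → ¬? (c″ v Fin.≟ c′ v)) split
    where
    split : ∀ v → c″ v ≢ c v → c′ v ≢ c v ⊎ c″ v ≢ c′ v
    split v c″≢c with c′ v Fin.≟ c v
    ... | no c′≢c = inj₁ c′≢c
    ... | yes c′≡c = inj₂ λ c″≡c′ → c″≢c (trans c″≡c′ c′≡c)

  -- If both `u` and `v` kept their colors, these would still agree. This yields both the lower
  -- bound on the optimum and the cost forced by each request of the adversary.
  separate⇒recolorings>0 : ∀ (c c′ : Coloring n Δ) {u v} → c u ≡ c v → c′ u ≢ c′ v →
                           1 ≤ recolorings c c′
  separate⇒recolorings>0 c c′ {u} {v} cu≡cv c′u≢c′v with c′ u Fin.≟ c u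
  ... | no c′u≢cu = #>0 (λ x → ¬? (c′ x Fin.≟ c x)) c′u≢cu
  ... | yes c′u≡cu = #>0 (λ x → ¬? (c′ x Fin.≟ c x)) {v}
          λ c′v≡cv → c′u≢c′v (trans c′u≡cu (trans cu≡cv (sym c′v≡cv)))

  totalCost-suc : ∀ c {T} (cs : Vector (Coloring n Δ) (suc T)) →
                  totalCost c cs ≡ recolorings c (cs zero) + totalCost (cs zero) (cs ∘ suc)
  totalCost-suc c {T} cs = cong (_+_ (recolorings c (cs zero)))
    -- The two ways of looking up the previous coloring agree only after a case split on the index.
    (sum-cong-≗ {T} λ { zero → refl ; (suc _) → refl })

  totalCost-const : ∀ (c : Coloring n Δ) T → totalCost c (const {B = Fin T} c) ≡ 0
  totalCost-const c zero    = refl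
  totalCost-const c (suc T) = begin
    totalCost c (const {B = Fin (suc T)} c)             ≡⟨ totalCost-suc c {T} (const c) ⟩
    recolorings c c + totalCost c (const {B = Fin T} c) ≡⟨ cong₂ _+_ (recolorings-refl c) (totalCost-const c T) ⟩
    0                                                   ∎
    where open ≡-Reasoning

  -- Stated for an arbitrary response function, since inductions on `σ` pass to `f ∘ (e ∷_)`, which
  -- need not come from an online algorithm started at `c₀`. For `respond` it is `cost`.
  responseCost : Coloring n Δ → (List (Edge n) → Coloring n Δ) → List (Edge n) → ℕ
  responseCost c f σ = totalCost c (f ∘ prefix σ)

  current : Coloring n Δ → (List (Edge n) → Coloring n Δ) → List (Edge n) → Coloring n Δ
  current c f []      = c
  current c f (e ∷ σ) = f (e ∷ σ)

  current-∷ : ∀ c f e σ → current c f (e ∷ σ) ≡ current (f (e ∷ [])) (f ∘ (e ∷_)) σ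
  current-∷ c f e []      = refl
  current-∷ c f e (_ ∷ _) = refl

  responseCost-∷ : ∀ c f e σ → responseCost c f (e ∷ σ) ≡
    recolorings c (f (e ∷ [])) + responseCost (f (e ∷ [])) (f ∘ (e ∷_)) σ
  responseCost-∷ c f e σ = totalCost-suc c (f ∘ prefix (e ∷ σ))

  -- The sum in `totalCost` unfolds from the first request, while the adversary appends requests at
  -- the end. This converts the one into the other.
  responseCost-∷ʳ : ∀ c f σ e → responseCost c f (σ ∷ʳ e) ≡
    responseCost c f σ + recolorings (current c f σ) (current c f (σ ∷ʳ e))
  responseCost-∷ʳ c f [] e = ℕ.+-identityʳ _
  responseCost-∷ʳ c f (x ∷ σ) e = begin
    responseCost c f (x ∷ σ ∷ʳ e)
      ≡⟨ responseCost-∷ c f x (σ ∷ʳ e) ⟩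
    r + responseCost c₁ f₁ (σ ∷ʳ e)
      ≡⟨ cong (_+_ r) (responseCost-∷ʳ c₁ f₁ σ e) ⟩
    r + (responseCost c₁ f₁ σ + recolorings (current c₁ f₁ σ) (current c₁ f₁ (σ ∷ʳ e)))
      ≡⟨ ℕ.+-assoc r _ _ ⟨
    r + responseCost c₁ f₁ σ + recolorings (current c₁ f₁ σ) (current c₁ f₁ (σ ∷ʳ e))
      ≡⟨ cong₂ _+_ (responseCost-∷ c f x σ)
           (cong₂ recolorings (current-∷ c f x σ) (current-∷ c f x (σ ∷ʳ e))) ⟨
    responseCost c f (x ∷ σ) + recolorings (current c f (x ∷ σ)) (current c f (x ∷ σ ∷ʳ e)) ∎
    where
    open ≡-Reasoning
    c₁ = f (x ∷ [])
    f₁ = f ∘ (x ∷_)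
    r = recolorings c c₁

  -- Iterated triangle inequality: every vertex that has left its initial color was paid for at
  -- least once.
  recolorings-current≤ : ∀ c f σ → recolorings c (current c f σ) ≤ responseCost c f σ
  recolorings-current≤ c f [] = ℕ.≤-reflexive (recolorings-refl c)
  recolorings-current≤ c f (e ∷ σ) = begin
    recolorings c (current c f (e ∷ σ))
      ≡⟨ cong (recolorings c) (current-∷ c f e σ) ⟩
    recolorings c (current c₁ f₁ σ)
      ≤⟨ recolorings-triangle c c₁ (current c₁ f₁ σ) ⟩
    recolorings c c₁ + recolorings c₁ (current c₁ f₁ σ)
      ≤⟨ ℕ.+-monoʳ-≤ _ (recolorings-current≤ c₁ f₁ σ) ⟩
    recolorings c c₁ + responseCost c₁ f₁ σ
      ≡⟨ responseCost-∷ c f e σ ⟨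
    responseCost c f (e ∷ σ) ∎
    where
    open ℕ.≤-Reasoning
    c₁ = f (e ∷ [])
    f₁ = f ∘ (e ∷_)

  -- Proper colorings and the offline optimum of a star.

  bichromatic⇒Proper : ∀ (c : Coloring n Δ) {σ} → All (λ e → c (src e) ≢ c (dst e)) σ → Proper σ c
  bichromatic⇒Proper c (e≢ ∷ _) _ _ (here (inj₁ (refl , refl))) = e≢
  bichromatic⇒Proper c (e≢ ∷ _) _ _ (here (inj₂ (refl , refl))) = ≢-sym e≢
  bichromatic⇒Proper c (_ ∷ es) u v (there a)                   = bichromatic⇒Proper c es u v a

  -- The last index has value `length σ′`, and `prefix` takes one request more than that, so it
  -- returns all of `σ`.
  maintains⇒proper : ∀ c f σ → MaintainsProper σ (f ∘ prefix σ) → Proper σ (current c f σ)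
  maintains⇒proper c f [] _ u v ()
  maintains⇒proper c f σ@(_ ∷ σ′) mp = subst (λ τ → Proper τ (f τ)) prefix-last (mp (Fin.fromℕ (length σ′)))
    where
    prefix-last : prefix σ (Fin.fromℕ (length σ′)) ≡ σ
    prefix-last = take-all _ σ (s≤s (ℕ.≤-reflexive (sym (Fin.toℕ-fromℕ (length σ′)))))

  -- Forces the optimum of a nonempty request sequence to be positive.
  StartsMonochromatic : Coloring n Δ → List (Edge n) → Set
  StartsMonochromatic c []      = ⊤
  StartsMonochromatic c (e ∷ _) = c (src e) ≡ c (dst e)

  module _ (c₀ : Coloring n Δ) (v : Fin n) where

    -- v moves once, to a color that c₀ gives to none of its at most Δ − 1 neighbors.
    star-IsOPT : ∀ e σ → All (λ e′ → src e′ ≡ v) (e ∷ σ) → StartsMonochromatic c₀ (e ∷ σ) →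
                 length (e ∷ σ) < Δ → IsOPT c₀ (e ∷ σ) 1
    star-IsOPT e σ star mono |σ|<Δ =
      (const c* , maintains , ℕ.≤-antisym cost*≤1 (lower (const c*) maintains)) , lower
      where
      τ = e ∷ σ
      k∉ = ∃∉ (map (c₀ ∘ dst) τ) (subst (_< Δ) (sym (length-map (c₀ ∘ dst) τ)) |σ|<Δ)
      k = proj₁ k∉

      c* : Coloring n Δ
      c* = updateAt c₀ v (const k)

      changed : ∀ {x} → c* x ≢ c₀ x → x ≡ v
      changed {x} c*≢c₀ = decidable-stable (x Fin.≟ v) λ x≢v → c*≢c₀ (updateAt-minimal x v c₀ x≢v)

      separates : ∀ {e′} → src e′ ≡ v → e′ ∈ τ → c* (src e′) ≢ c* (dst e′)
      separates {edge s t s≢t} refl e′∈τ eq = proj₂ k∉ (subst (_∈ map (c₀ ∘ dst) τ) (sym k≡) (∈-map⁺ (c₀ ∘ dst) e′∈τ))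
        where
        k≡ : k ≡ c₀ t
        -- The field `distinct` is irrelevant, so a usable proof of `t ≢ s` is recovered by deciding
        -- equality.
        k≡ with t Fin.≟ s
        ... | yes t≡s = ⊥-elim-irr (s≢t (sym t≡s))
        ... | no t≢s = trans (sym (updateAt-updates s c₀)) (trans eq (updateAt-minimal t s c₀ t≢s))

      maintains : MaintainsProper τ (const c*)
      maintains t = bichromatic⇒Proper c* (All.take⁺ (suc (toℕ t))
        (All.tabulate λ e′∈τ → separates (All.lookup star e′∈τ) e′∈τ))

      cost*≤1 : totalCost c₀ (const {B = Fin (length τ)} c*) ≤ 1
      cost*≤1 = begin
        totalCost c₀ (const {B = Fin (length τ)} c*)
          ≡⟨ totalCost-suc c₀ {length σ} (const c*) ⟩
        recolorings c₀ c* + totalCost c* (const {B = Fin (length σ)} c*)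
          ≡⟨ cong (_+_ _) (totalCost-const c* (length σ)) ⟩
        recolorings c₀ c* + 0
          ≡⟨ ℕ.+-identityʳ _ ⟩
        recolorings c₀ c*
          ≤⟨ #≤1 _ (λ p q → trans (changed p) (sym (changed q))) ⟩
        1 ∎
        where open ℕ.≤-Reasoning

      -- The first request joins two vertices of equal initial color, so already the first output
      -- coloring must move one of them.
      lower : ∀ cs → MaintainsProper τ cs → 1 ≤ totalCost c₀ cs
      lower cs mp = subst (1 ≤_) (sym (totalCost-suc c₀ cs))
        (ℕ.m≤n⇒m≤n+o _ (separate⇒recolorings>0 c₀ (cs zero) mono
          (mp zero _ _ (here (inj₁ (refl , refl))))))

-- The adaptive adversary.

module Adversary {n Δ : ℕ} .{{_ : NonZero Δ}} {ε : ℝ} {c₀ : Coloring n Δ} (balanced : Balanced c₀)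
                 (A : OnlineAlgorithm ε c₀) (v : Fin n)
                 -- `d<Δ` leaves the optimum a free color for `v`. `d<n/Δ` lets each initial color
                 -- class outlast `v` and fewer than `d` moved vertices.
                 (d : ℕ) (d<Δ : d < Δ) (d<n/Δ : d < n / Δ)
                 (admissible : ∀ (σ : List (Edge n)) → length σ ≤ d → Admissible ε Δ σ) where

  open OnlineAlgorithm A

  now : List (Edge n) → Coloring n Δ
  now = current c₀ respond

  module _ (σ : List (Edge n)) where

    -- The last condition uses `c₀ u` instead of `now σ u`, which is the same for an unmoved vertex,
    -- so that fresh vertices can be counted inside an initial color class.
    Fresh : Fin n → Set
    Fresh u = (u ≢ v × now σ u ≡ c₀ u) × c₀ u ≡ now σ v

    fresh? : Decidable Fresh
    fresh? u = (¬? (u Fin.≟ v) ×-dec now σ u Fin.≟ c₀ u) ×-dec c₀ u Fin.≟ now σ v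

    v-or-fresh? : Decidable (λ u → u ≡ v ⊎ Fresh u)
    v-or-fresh? u = u Fin.≟ v ⊎-dec fresh? u

    moved⊎v⊎fresh : ∀ u → c₀ u ≡ now σ v → now σ u ≢ c₀ u ⊎ u ≡ v ⊎ Fresh u
    moved⊎v⊎fresh u c₀u≡ with now σ u Fin.≟ c₀ u | u Fin.≟ v
    ... | no ≢c₀  | _       = inj₁ ≢c₀
    ... | yes _   | yes u≡v = inj₂ (inj₁ u≡v)
    ... | yes ≡c₀ | no u≢v  = inj₂ (inj₂ ((u≢v , ≡c₀) , c₀u≡))

    classSize≤ : classSize c₀ (now σ v) ≤ recolorings c₀ (now σ) + #[ v-or-fresh? ]
    classSize≤ = #-∪ (λ u → c₀ u Fin.≟ now σ v) (λ u → ¬? (now σ u Fin.≟ c₀ u)) v-or-fresh? moved⊎v⊎fresh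

    #v-or-fresh≤ : #[ v-or-fresh? ] ≤ 1 + #[ fresh? ]
    #v-or-fresh≤ = ℕ.≤-trans (#-∪ v-or-fresh? (Fin._≟ v) fresh? λ _ → id)
      (ℕ.+-monoˡ-≤ #[ fresh? ] (#≤1 (Fin._≟ v) λ p q → trans p (sym q)))

    -- The initial class of the current color of `v` has at least `d + 1` vertices. At most
    -- `cost σ`, hence at most `d - 1`, of them have moved, and one more may be `v` itself.
    ∃-fresh : cost σ < d → ∃ Fresh
    ∃-fresh cost<d = #>0⇒∃ fresh? (ℕ.+-cancelˡ-≤ d 1 #[ fresh? ] (begin
      d + 1                                       ≡⟨ ℕ.+-comm d 1 ⟩
      suc d                                       ≤⟨ d<n/Δ ⟩
      n / Δ                                       ≡⟨ balanced (now σ v) ⟨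
      classSize c₀ (now σ v)                      ≤⟨ classSize≤ ⟩
      recolorings c₀ (now σ) + #[ v-or-fresh? ]
        ≤⟨ ℕ.+-mono-≤ (recolorings-current≤ c₀ respond σ) #v-or-fresh≤ ⟩
      cost σ + suc #[ fresh? ]                    ≡⟨ ℕ.+-suc (cost σ) #[ fresh? ] ⟩
      suc (cost σ) + #[ fresh? ]                  ≤⟨ ℕ.+-monoˡ-≤ #[ fresh? ] cost<d ⟩
      d + #[ fresh? ]                             ∎))
      where open ℕ.≤-Reasoning

  -- The index bounds the number of requests from above and the cost from below. These can differ,
  -- since one request may trigger several recolorings. `star` and `mono` are what `star-IsOPT` asks
  -- for.
  record Stage (k : ℕ) : Set where
    constructor mkStage
    field
      requests : List (Edge n)
      star     : All (λ e → src e ≡ v) requests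
      mono     : StartsMonochromatic c₀ requests
      short    : length requests ≤ k
      costly   : k ≤ cost requests

  -- Before the new request `u` and `v` share a color, and afterwards properness separates them, so
  -- at least one recoloring is added.
  extend : ∀ {k} → k < d → (S : Stage k) → ∃ (Fresh (Stage.requests S)) → Stage (suc k)
  extend {k} k<d (mkStage σ star mono short costly) (u , (u≢v , now≡c₀) , c₀u≡nowv) =
    mkStage σ′ (All.∷ʳ⁺ star refl) (mono′ σ c₀u≡nowv mono) short′ costly′
    where
    e : Edge n
    e = edge v u (≢-sym u≢v)

    σ′ : List (Edge n)
    σ′ = σ ∷ʳ e

    short′ : length σ′ ≤ suc k
    short′ = subst (_≤ suc k) (sym (trans (length-++ σ) (ℕ.+-comm (length σ) 1))) (s≤s short)

    mono′ : ∀ τ → c₀ u ≡ now τ v → StartsMonochromatic c₀ τ → StartsMonochromatic c₀ (τ ∷ʳ e)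
    -- Only here is the new request the first one, and the current coloring is still `c₀`.
    mono′ []      c₀u≡c₀v _  = sym c₀u≡c₀v
    mono′ (_ ∷ _) _       m  = m

    separated : now σ′ v ≢ now σ′ u
    separated = maintains⇒proper c₀ respond σ′
      (proper σ′ (admissible σ′ (ℕ.≤-trans short′ k<d))) v u
      (Any.++⁺ʳ σ (here (inj₁ (refl , refl))))

    costly′ : suc k ≤ cost σ′
    costly′ = begin
      suc k                                      ≡⟨ ℕ.+-comm 1 k ⟩
      k + 1                                      ≤⟨ ℕ.+-mono-≤ costly
        (separate⇒recolorings>0 (now σ) (now σ′) {v} {u} (sym (trans now≡c₀ c₀u≡nowv)) separated) ⟩
      cost σ + recolorings (now σ) (now σ′)      ≡⟨ responseCost-∷ʳ c₀ respond σ e ⟨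
      cost σ′                                    ∎
      where open ℕ.≤-Reasoning

  -- If the cost already exceeds `k`, the same requests serve for `suc k`. Otherwise the cost is at
  -- most `k`, hence below `d`, and a fresh vertex exists.
  advance : ∀ {k} → k < d → (S : Stage k) → Dec (suc k ≤ cost (Stage.requests S)) → Stage (suc k)
  advance _ (mkStage σ star mono short _) (yes k<cost) = mkStage σ star mono (ℕ.m≤n⇒m≤1+n short) k<cost
  advance k<d S (no k≮cost) =
    extend k<d S (∃-fresh (Stage.requests S) (ℕ.≤-<-trans (ℕ.≮⇒≥ k≮cost) k<d))

  stage : ∀ k → k ≤ d → Stage k
  stage zero    _   = mkStage [] [] _ z≤n z≤n
  stage (suc k) k<d = advance k<d S (suc k ℕ.≤? cost (Stage.requests S))
    where
    S : Stage k
    S = stage k (ℕ.<⇒≤ k<d)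

  costly-request-sequence : 0 < d → ∃[ σ ] Admissible ε Δ σ × IsOPT c₀ σ 1 × d ≤ cost σ
  costly-request-sequence 0<d = conclude (stage d ℕ.≤-refl)
    where
    conclude : Stage d → _
    -- The empty sequence has optimum 0. It is ruled out because its cost 0 would have to reach the
    -- positive `d`.
    conclude (mkStage [] _ _ _ d≤0) = contradiction d≤0 (ℕ.<⇒≱ 0<d)
    conclude (mkStage σ@(e ∷ σ⁻) star mono short costly) =
      σ , admissible σ short , star-IsOPT c₀ v e σ⁻ star mono (ℕ.≤-<-trans short d<Δ) , costly

-- Arithmetic of `ι m`, the constant approximation of `fromℕ m`.

ι : ℕ → ℚ
ι m = + m ℚ./ 1

toℚᵘ-ι : ∀ m → toℚᵘ (ι m) ℚᵘ.≃ mkℚᵘ (+ m) 0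
toℚᵘ-ι m = ℚ.toℚᵘ-fromℚᵘ (mkℚᵘ (+ m) 0)

ι-nonNeg : ∀ m → ℚ.NonNegative (ι m)
ι-nonNeg m = ℚ.normalize-nonNeg m 1

ι-mono-≤ : ∀ {m n} → m ≤ n → ι m ℚ.≤ ι n
ι-mono-≤ {m} {n} m≤n = ℚ.toℚᵘ-cancel-≤ (begin
  toℚᵘ (ι m)     ≃⟨ toℚᵘ-ι m ⟩
  mkℚᵘ (+ m) 0   ≤⟨ ℚᵘ.*≤* (ℤ.*-monoʳ-≤-nonNeg (+ 1) (ℤ.+≤+ m≤n)) ⟩
  mkℚᵘ (+ n) 0   ≃⟨ toℚᵘ-ι n ⟨
  toℚᵘ (ι n)     ∎)
  where open ℚᵘ.≤-Reasoning

ι-homo-+ : ∀ m n → ι (m + n) ≡ ι m ℚ.+ ι n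
ι-homo-+ m n = ℚ.toℚᵘ-injective (begin
  toℚᵘ (ι (m + n))                   ≈⟨ toℚᵘ-ι (m + n) ⟩
  mkℚᵘ (+ (m + n)) 0                 ≈⟨ *≡* (cong (ℤ._* + 1) (sym (cong₂ ℤ._+_ (ℤ.*-identityʳ (+ m)) (ℤ.*-identityʳ (+ n))))) ⟩
  mkℚᵘ (+ m) 0 ℚᵘ.+ mkℚᵘ (+ n) 0     ≈⟨ ℚᵘ.+-cong (toℚᵘ-ι m) (toℚᵘ-ι n) ⟨
  toℚᵘ (ι m) ℚᵘ.+ toℚᵘ (ι n)         ≈⟨ ℚ.toℚᵘ-homo-+ (ι m) (ι n) ⟨
  toℚᵘ (ι m ℚ.+ ι n)                 ∎)
  where open ℚᵘ.≃-Reasoning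

ι-homo-* : ∀ m n → ι (m * n) ≡ ι m ℚ.* ι n
ι-homo-* m n = ℚ.toℚᵘ-injective (begin
  toℚᵘ (ι (m * n))                   ≈⟨ toℚᵘ-ι (m * n) ⟩
  mkℚᵘ (+ (m * n)) 0                 ≈⟨ *≡* (cong (ℤ._* + 1) (ℤ.pos-* m n)) ⟩
  mkℚᵘ (+ m) 0 ℚᵘ.* mkℚᵘ (+ n) 0     ≈⟨ ℚᵘ.*-cong (toℚᵘ-ι m) (toℚᵘ-ι n) ⟨
  toℚᵘ (ι m) ℚᵘ.* toℚᵘ (ι n)         ≈⟨ ℚ.toℚᵘ-homo-* (ι m) (ι n) ⟨
  toℚᵘ (ι m ℚ.* ι n)                 ∎)
  where open ℚᵘ.≃-Reasoning

approx-· : ∀ m x i → approx (m · x) i ≡ ι m ℚ.* approx x i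
approx-· zero    x i = sym (ℚ.*-zeroˡ (approx x i))
approx-· (suc m) x i = begin
  a ℚ.+ approx (m · x) i         ≡⟨ cong₂ ℚ._+_ (sym (ℚ.*-identityˡ a)) (approx-· m x i) ⟩
  1ℚ ℚ.* a ℚ.+ ι m ℚ.* a         ≡⟨ ℚ.*-distribʳ-+ a 1ℚ (ι m) ⟨
  (1ℚ ℚ.+ ι m) ℚ.* a             ≡⟨ cong (ℚ._* a) (ι-homo-+ 1 m) ⟨
  ι (suc m) ℚ.* a                ∎
  where
  open ≡-Reasoning
  a = approx x i

-- `mkℚ` stores the denominator minus one, so `suc q` would do for the inequality. One more makes
-- the multiplier at least 2, whence `Δ / Q < Δ` later.
archimedean : ∀ δ → 0ℚ ℚ.< δ → ∃[ q ] 1ℚ ℚ.≤ ι (suc (suc q)) ℚ.* δ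
archimedean δ@(mkℚ -[1+ _ ] _ _) 0<δ = contradiction (ℚ.positive 0<δ) λ ()
archimedean δ@(mkℚ (+ 0) _ _)    0<δ = contradiction (ℚ.positive 0<δ) λ ()
archimedean δ@(mkℚ (+ suc p) q _) _ = q , ℚ.toℚᵘ-cancel-≤ (begin
  toℚᵘ 1ℚ                                       ≤⟨ ℚᵘ.*≤* (ℤ.+≤+ ineq) ⟩
  mkℚᵘ (+ suc (suc q)) 0 ℚᵘ.* mkℚᵘ (+ suc p) q  ≃⟨ ℚᵘ.*-congʳ (toℚᵘ-ι (suc (suc q))) ⟨
  toℚᵘ (ι (suc (suc q))) ℚᵘ.* toℚᵘ δ            ≃⟨ ℚ.toℚᵘ-homo-* (ι (suc (suc q))) δ ⟨
  toℚᵘ (ι (suc (suc q)) ℚ.* δ)                  ∎)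
  where
  open ℚᵘ.≤-Reasoning
  ineq : 1 * suc (q + 0) ≤ suc (suc q) * suc p * 1
  ineq = subst₂ _≤_ (sym (trans (ℕ.*-identityˡ _) (cong suc (ℕ.+-identityʳ q)))) (sym (ℕ.*-identityʳ _))
    (ℕ.≤-trans (ℕ.n≤1+n (suc q)) (ℕ.m≤m*n (suc (suc q)) (suc p)))

-- Admissibility of short request sequences.

module _ {ε : ℝ} {δ : ℚ} {N : ℕ} (δ>0 : 0ℚ ℚ.< δ) (ε+δ≤1 : ∀ i → N ≤ i → approx ε i ℚ.+ δ ℚ.≤ 1ℚ)
         {Q : ℕ} (1≤Qδ : 1ℚ ℚ.≤ ι Q ℚ.* δ) where

  -- The maximum degree is at most `d`, and `d ≤ d * Q * δ ≤ Δ * δ ≤ Δ * (1 - ε)`. As `≤ℝ` is a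
  -- negation, a supposed strict gap is refuted at a single index beyond both thresholds.
  short⇒Admissible : ∀ {n Δ d} → d * Q ≤ Δ → ∀ (σ : List (Edge n)) → length σ ≤ d → Admissible ε Δ σ
  short⇒Admissible {Δ = Δ} {d} dQ≤Δ σ |σ|≤d (δ′ , δ′>0 , N′ , gap) = ℚ.<-irrefl refl (begin-strict
    ι (maxDegree σ)          ≤⟨ ι-mono-≤ (ℕ.≤-trans (maxDegree≤length σ) |σ|≤d) ⟩
    ι d                      ≡⟨ ℚ.*-identityʳ (ι d) ⟨
    ι d ℚ.* 1ℚ               ≤⟨ ℚ.*-monoˡ-≤-nonNeg (ι d) {{ι-nonNeg d}} 1≤Qδ ⟩
    ι d ℚ.* (ι Q ℚ.* δ)      ≡⟨ ℚ.*-assoc (ι d) (ι Q) δ ⟨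
    ι d ℚ.* ι Q ℚ.* δ        ≡⟨ cong (ℚ._* δ) (ι-homo-* d Q) ⟨
    ι (d * Q) ℚ.* δ          ≤⟨ ℚ.*-monoʳ-≤-nonNeg δ {{ℚ.pos⇒nonNeg δ {{ℚ.positive δ>0}}}} (ι-mono-≤ dQ≤Δ) ⟩
    ι Δ ℚ.* δ                ≤⟨ ℚ.*-monoˡ-≤-nonNeg (ι Δ) {{ι-nonNeg Δ}} δ≤1-ε ⟩
    ι Δ ℚ.* approx (1ℝ -ℝ ε) i ≡⟨ approx-· Δ (1ℝ -ℝ ε) i ⟨
    approx (Δ · (1ℝ -ℝ ε)) i ≡⟨ ℚ.+-identityʳ (approx (Δ · (1ℝ -ℝ ε)) i) ⟨
    approx (Δ · (1ℝ -ℝ ε)) i ℚ.+ 0ℚ <⟨ ℚ.+-monoʳ-< (approx (Δ · (1ℝ -ℝ ε)) i) δ′>0 ⟩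
    approx (Δ · (1ℝ -ℝ ε)) i ℚ.+ δ′ ≤⟨ gap i (ℕ.m≤n⊔m N N′) ⟩
    ι (maxDegree σ)          ∎)
    where
    open ℚ.≤-Reasoning
    i = N ℕ.⊔ N′
    a = approx ε i
    δ≤1-ε : δ ℚ.≤ 1ℚ ℚ.- a
    δ≤1-ε = let open +-*-Solver in begin
      δ                    ≡⟨ solve 2 (λ a δ → δ := a :+ δ :- a) refl a δ ⟩
      a ℚ.+ δ ℚ.- a        ≤⟨ ℚ.+-monoˡ-≤ (ℚ.- a) (ε+δ≤1 i (ℕ.m≤m⊔n N N′)) ⟩
      1ℚ ℚ.- a             ∎

theorem5 : ∀ (ε : ℝ) → 0ℝ <ℝ ε → ε <ℝ 1ℝ →
    ∃[ κ ] 0ℝ <ℝ κ × (∃[ Δ₀ ]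
    ∀ (Δ : ℕ) .{{_ : NonZero Δ}} → Δ₀ ≤ Δ →
    ∃[ n₀ ] ∀ (n : ℕ) → n₀ ≤ n → Δ ∣ n →
    ∀ (c₀ : Coloring n Δ) → Balanced c₀ →
    ∀ (A : OnlineAlgorithm ε c₀) (α : ℝ) →
    Competitive A α → Δ · κ ≤ℝ α)
theorem5 ε _ (δ , δ>0 , N , ε+δ≤1) =
  fromℚ κ , (κ , κ>0 , 0 , λ _ _ → ℚ.≤-reflexive (ℚ.+-identityˡ κ)) , Q , bound
  where
  q = proj₁ (archimedean δ δ>0)
  Q = suc (suc q)
  -- The factor 2 pays for rounding down in `d = Δ / Q`: the remainder is at most `Q`, hence at most
  -- `d * Q` once `d` is positive, which `Q ≤ Δ` ensures.
  K = Q + Q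
  instance
    ιK-pos : ℚ.Positive (ι K)
    ιK-pos = ℚ.normalize-pos K 1
    ιK-nonZero : ℚ.NonZero (ι K)
    ιK-nonZero = ℚ.pos⇒nonZero (ι K)
  κ = ℚ.1/ ι K
  κ-pos : ℚ.Positive κ
  κ-pos = ℚ.1/pos⇒pos (ι K)
  κ>0 : 0ℚ ℚ.< κ
  κ>0 = ℚ.positive⁻¹ κ {{κ-pos}}

  module _ (Δ : ℕ) .{{_ : NonZero Δ}} (Q≤Δ : Q ≤ Δ) where
    d = Δ / Q

    d>0 : 0 < d
    d>0 = ℕ.m≥n⇒m/n>0 Q≤Δ

    d<Δ : d < Δ
    d<Δ = ℕ.m/n<m Δ Q (s≤s (s≤s z≤n))

    Δ≤dK : Δ ≤ d * K
    Δ≤dK = begin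
      Δ                  ≡⟨ ℕ.m≡m%n+[m/n]*n Δ Q ⟩
      Δ ℕ.% Q + d * Q    ≤⟨ ℕ.+-monoˡ-≤ (d * Q) (ℕ.m%n≤n Δ Q) ⟩
      Q + d * Q          ≤⟨ ℕ.+-monoˡ-≤ (d * Q) (ℕ.m≤n*m Q d {{ℕ.>-nonZero d>0}}) ⟩
      d * Q + d * Q      ≡⟨ ℕ.*-distribˡ-+ d Q Q ⟨
      d * K              ∎
      where open ℕ.≤-Reasoning

    Δκ≤d : ι Δ ℚ.* κ ℚ.≤ ι d
    Δκ≤d = begin
      ι Δ ℚ.* κ            ≤⟨ ℚ.*-monoʳ-≤-nonNeg κ {{ℚ.pos⇒nonNeg κ {{κ-pos}}}} (ι-mono-≤ Δ≤dK) ⟩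
      ι (d * K) ℚ.* κ      ≡⟨ cong (ℚ._* κ) (ι-homo-* d K) ⟩
      ι d ℚ.* ι K ℚ.* κ    ≡⟨ ℚ.*-assoc (ι d) (ι K) κ ⟩
      ι d ℚ.* (ι K ℚ.* κ)  ≡⟨ cong (ι d ℚ.*_) (ℚ.*-inverseʳ (ι K)) ⟩
      ι d ℚ.* 1ℚ           ≡⟨ ℚ.*-identityʳ (ι d) ⟩
      ι d                  ∎
      where open ℚ.≤-Reasoning

    bound : ∃[ n₀ ] ∀ (n : ℕ) → n₀ ≤ n → Δ ∣ n →
      ∀ (c₀ : Coloring n Δ) → Balanced c₀ →
      ∀ (A : OnlineAlgorithm ε c₀) (α : ℝ) → Competitive A α → Δ · fromℚ κ ≤ℝ α
    -- This threshold makes the class size `n / Δ` at least `suc d`.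
    bound = suc d * Δ , λ n n₀≤n _ c₀ balanced A α competitive (δ′ , δ′>0 , N′ , gap) →
      let v = fromℕ< {0} (ℕ.<-≤-trans (ℕ.<-≤-trans (ℕ.≤-<-trans z≤n d<Δ) (ℕ.m≤m+n Δ (d * Δ))) n₀≤n)
          d<n/Δ = subst (_≤ n / Δ) (ℕ.m*n/n≡m (suc d) Δ) (ℕ./-monoˡ-≤ Δ n₀≤n)
          admissible = short⇒Admissible {ε} {δ} δ>0 ε+δ≤1 {Q} (proj₂ (archimedean δ δ>0)) (ℕ.m/n*n≤m Δ Q)
          open Adversary balanced A v d d<Δ d<n/Δ admissible
          σ , σ-admissible , opt≡1 , d≤cost = costly-request-sequence d>0
      -- If `α` were below `Δ · fromℚ κ` by `δ′`, then `1 · α` would be below the cost by the same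
      -- `δ′`, against competitiveness at optimum 1. The summand `0ℚ` arises because `1 · α` unfolds
      -- to `α +ℝ 0ℝ`.
      in competitive σ σ-admissible 1 opt≡1
           (δ′ , δ′>0 , N′ , λ i N′≤i → let open ℚ.≤-Reasoning in begin
             approx α i ℚ.+ 0ℚ ℚ.+ δ′    ≡⟨ cong (ℚ._+ δ′) (ℚ.+-identityʳ (approx α i)) ⟩
             approx α i ℚ.+ δ′           ≤⟨ gap i N′≤i ⟩
             approx (Δ · fromℚ κ) i      ≡⟨ approx-· Δ (fromℚ κ) i ⟩
             ι Δ ℚ.* κ                   ≤⟨ Δκ≤d ⟩
             ι d                         ≤⟨ ι-mono-≤ d≤cost ⟩
             ι (OnlineAlgorithm.cost A σ) ∎)
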